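{- Let $r\ge3$ be an integer and let $k_1<\cdots<k_r$ be elements of $\mathcal{C}^{o}_{>1}$. If $\pi(k_i)\ge i+2$ for all $i\in\{1,\dots,r\}$, then $2\,\mathbb{Z}^{o}_{\ge3}=2\,(\mathbb{Z}^{o}_{\ge3}\setminus\{k_1,\dots,k_r\})$, and $\{k_1,\dots,k_r\}$ is a 2-th sum-factor collapsed subset of $\mathbb{Z}^{o}_{\ge3}$.
   Context: $\mathbb{Z}^{o}_{\ge3}$ is the set of all odd integers $\ge3$; $\mathcal{C}^{o}_{>1}$ is the set of all odd composite positive integers ($9,15,21,25,\dots$); $\pi(x)$ is the number of primes $\le x$. For a non-empty set $S$ of integers, $2S=\{s+s': s,s'\in S\}$ (the sumset, not the dilation). A subset $C\subset B$ (with $B$ a non-empty set of integers) is a 2-th sum-factor collapsed subset of $B$ if $B\setminus C$ is non-empty, $2B=2(B\setminus C)$, and every $b\in B$ is a product $c_1\cdots c_k$ with $k\ge1$ and all $c_j\in B\setminus C$. -}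

module Defs where

open import Data.Fin.Base using (Fin)
open import Data.Integer.Base using (ℤ; +_; -[1+_]; 0ℤ; 1ℤ; ∣_∣; _+_; _*_; _≤_; _<_)
open import Data.List.Base using (List; foldr; length; filter; upTo)
open import Data.List.NonEmpty.Base using (List⁺; toList)
open import Data.List.Relation.Unary.All using (All)
open import Data.Nat.Base as ℕ using (ℕ; suc)
open import Data.Nat.Primality using (Composite; prime?)
open import Data.Product.Base using (∃; ∃₂; _×_)
open import Level using (0ℓ)
open import Relation.Binary.PropositionalEquality.Core using (_≡_)
open import Relation.Unary using (Pred; _∈_; _⊆_; _≐_; _∖_; Satisfiable)

Odd : Pred ℤ 0ℓ
Odd z = ∃ λ m → z ≡ + 2 * m + 1ℤ

ℤᵒ≥3 : Pred ℤ 0ℓ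
ℤᵒ≥3 z = Odd z × + 3 ≤ z

𝒞ᵒ>1 : Pred ℤ 0ℓ
𝒞ᵒ>1 z = Odd z × 0ℤ < z × Composite ∣ z ∣

-- The number of primes ≤ x, for an integer x.
π : ℤ → ℕ
π (+ n)    = length (filter prime? (upTo (suc n)))
π -[1+ n ] = 0

-- The sumset { s + s′ : s, s′ ∈ S }, usually written 2S (not the dilation).
infix 8 2⊕_
2⊕_ : Pred ℤ 0ℓ → Pred ℤ 0ℓ
(2⊕ S) z = ∃₂ λ s s′ → s ∈ S × s′ ∈ S × z ≡ s + s′

Range : ∀ {r} → (Fin r → ℤ) → Pred ℤ 0ℓ
Range k z = ∃ λ i → z ≡ k i

product : List ℤ → ℤ
product = foldr _*_ 1ℤ

IsProductOf : Pred ℤ 0ℓ → Pred ℤ 0ℓ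
IsProductOf S b = ∃ λ (cs : List⁺ ℤ) → All (_∈ S) (toList cs) × b ≡ product (toList cs)

-- C is a 2-th sum-factor collapsed subset of B.
record SumFactorCollapsed₂ (C B : Pred ℤ 0ℓ) : Set where
  field
    B-nonEmpty   : Satisfiable B
    C⊆B          : C ⊆ B
    B∖C-nonEmpty : Satisfiable (B ∖ C)
    sumset-≐     : 2⊕ B ≐ 2⊕ (B ∖ C)
    factors      : B ⊆ IsProductOf (B ∖ C)

{-# OPTIONS --safe #-}
-- Let z = s + s′ with s, s′ ≥ 3 odd, and put M = z − 3. Suppose that z − p is one of the kᵢ
-- for each of the π(M) − 1 odd primes p ≤ M. Such a kᵢ is ≤ M, so i + 2 ≤ π(kᵢ) ≤ π(M), which
-- leaves at most π(M) − 2 indices i for π(M) − 1 primes: this contradicts the pigeonhole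
-- principle. So z = p + (z − p) for some odd prime p with z − p not among the kᵢ. The prime
-- factors of an odd number are odd and not composite, so the kᵢ are not needed as factors.
module Submission where

open import Defs
open import Data.Empty using (⊥-elim)
open import Data.Fin.Base as Fin using (Fin; toℕ)
open import Data.Fin.Properties using (any?; fromℕ<-injective; toℕ-injective; <⇒notInjective)
open import Data.Integer.Base as ℤ using (ℤ; +_; 0ℤ; 1ℤ; ∣_∣; +≤+)
import Data.Integer.Divisibility.Signed as ℤ∣
import Data.Integer.Properties as ℤ
open import Algebra.Properties.AbelianGroup ℤ.+-0-abelianGroup using (∙-cancelˡ)
open import Data.Integer.Tactic.RingSolver using (solve-∀)
open import Data.List.Base using (List; []; _∷_; [_]; length; lookup; filter; upTo; applyUpTo; map)
open import Data.List.Membership.Propositional.Properties using (∈-lookup; ∈-filter⁻; ∈-applyUpTo⁻)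
open import Data.List.NonEmpty.Base using (_∷_)
open import Data.List.Properties using (upTo-∷ʳ; filter-++; length-++)
open import Data.List.Relation.Unary.All as All using (All; []; _∷_)
open import Data.List.Relation.Unary.AllPairs using (_∷_)
open import Data.List.Relation.Unary.Unique.Propositional using (Unique)
import Data.List.Relation.Unary.Unique.Propositional.Properties as Unique
open import Data.Nat.Base using (ℕ; zero; suc; pred; _+_; _≤_; _≥_; z≤n; s≤s; s≤s⁻¹; nonTrivial⇒n>1; _≤′_; ≤′-refl; ≤′-step)
open import Data.Nat.Divisibility using (_∣_; divides; ∣-refl; ∣m∣n⇒∣m+n; ∣1⇒≡1)
import Data.Nat.ListAction as ℕ
open import Data.Nat.ListAction.Properties using (∈⇒∣product)
open import Data.Nat.Primality using (Prime; Composite; prime?; prime⇒irreducible; prime⇒nonTrivial; prime⇒¬composite; composite⇒nonTrivial)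
open import Data.Nat.Primality.Factorisation using (factorise; module PrimeFactorisation)
open import Data.Nat.Properties using (≤-trans; ≤-refl; ≤∧≢⇒<; m≤m+n; ≤⇒≤′; <⇒≢; +-cancelˡ-≡; +-comm; +-cancelʳ-≤; n<1+n; +-monoʳ-≤)
open import Data.Product.Base using (∃; _×_; _,_; proj₁; proj₂)
open import Data.Sum.Base using (_⊎_; inj₁; inj₂)
open import Function.Base using (_∘_)
open import Function.Definitions using (Injective)
open import Relation.Binary.PropositionalEquality using (_≡_; _≢_; refl; sym; trans; cong; subst)
open import Relation.Nullary using (¬_; yes; no; ¬?; contradiction)
open import Relation.Nullary.Decidable using (decidable-stable; toWitness)
open import Relation.Unary using (_∈_; _∉_; _⊆_; _≐_; _∖_; Decidable)

lookup-injective : ∀ {A : Set} {xs : List A} → Unique xs → Injective _≡_ _≡_ (lookup xs)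
lookup-injective (_  ∷ _) {Fin.zero}  {Fin.zero}  _  = refl
lookup-injective (x∉ ∷ _) {Fin.zero}  {Fin.suc j} eq = contradiction eq (All.lookup x∉ (∈-lookup j))
lookup-injective (x∉ ∷ _) {Fin.suc i} {Fin.zero}  eq = contradiction (sym eq) (All.lookup x∉ (∈-lookup i))
lookup-injective (_  ∷ u) {Fin.suc i} {Fin.suc j} eq = cong Fin.suc (lookup-injective u eq)

π-suc : ∀ n → π (+ n) ≤ π (+ suc n)
π-suc n = subst (π (+ n) ≤_) (sym eq) (m≤m+n _ _)
  where
  eq : π (+ suc n) ≡ π (+ n) + length (filter prime? [ suc n ])
  eq = trans (cong (length ∘ filter prime?) (sym (upTo-∷ʳ (suc n))))
      (trans (cong length (filter-++ prime? (upTo (suc n)) [ suc n ]))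
             (length-++ (filter prime? (upTo (suc n)))))

π-mono-≤ : ∀ {x y} → x ℤ.≤ y → π x ≤ π y
π-mono-≤ ℤ.-≤+       = z≤n
π-mono-≤ (ℤ.-≤- _)   = z≤n
π-mono-≤ (+≤+ m≤n)   = go (≤⇒≤′ m≤n)
  where
  go : ∀ {m n} → m ≤′ n → π (+ m) ≤ π (+ n)
  go ≤′-refl                 = ≤-refl
  go (≤′-step {n = n} m≤′n) = ≤-trans (go m≤′n) (π-suc n)

2∣n⊎odd : ∀ n → 2 ∣ n ⊎ Odd (+ n)
2∣n⊎odd 0 = inj₁ (divides 0 refl)
2∣n⊎odd 1 = inj₂ (0ℤ , refl)
2∣n⊎odd (suc (suc n)) with 2∣n⊎odd n
... | inj₁ 2∣n      = inj₁ (∣m∣n⇒∣m+n ∣-refl 2∣n)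
... | inj₂ (m , eq) = inj₂ (ℤ.suc m , trans (cong (λ x → + 2 ℤ.+ x) eq) (shift m))
  where
  shift : ∀ m → + 2 ℤ.+ (+ 2 ℤ.* m ℤ.+ 1ℤ) ≡ + 2 ℤ.* (1ℤ ℤ.+ m) ℤ.+ 1ℤ
  shift = solve-∀

odd⇒2∤ : ∀ {n} → Odd (+ n) → ¬ 2 ∣ n
-- If 2 divides 2m + 1, it divides the remainder 1. Signed divisibility serves here because the
-- witness `m` of oddness is an integer.
odd⇒2∤ {n} (m , eq) 2∣n with ∣1⇒≡1 (ℤ∣.∣⇒∣ᵤ (ℤ∣.∣m+n∣m⇒∣n 2∣2m+1 (ℤ∣.∣m⇒∣m*n m ℤ∣.∣-refl)))
  where
  2∣2m+1 : + 2 ℤ∣.∣ + 2 ℤ.* m ℤ.+ 1ℤ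
  2∣2m+1 = subst (+ 2 ℤ∣.∣_) eq (ℤ∣.∣ᵤ⇒∣ 2∣n)
... | ()

odd-+- : ∀ {x y w} → Odd x → Odd y → Odd w → Odd (x ℤ.+ y ℤ.- w)
odd-+- (a , refl) (b , refl) (c , refl) = a ℤ.+ b ℤ.- c , identity a b c
  where
  identity : ∀ a b c → (+ 2 ℤ.* a ℤ.+ 1ℤ) ℤ.+ (+ 2 ℤ.* b ℤ.+ 1ℤ) ℤ.- (+ 2 ℤ.* c ℤ.+ 1ℤ)
                     ≡ + 2 ℤ.* (a ℤ.+ b ℤ.- c) ℤ.+ 1ℤ
  identity = solve-∀

prime≢2⇒odd≥3 : ∀ {p} → Prime p → p ≢ 2 → + p ∈ ℤᵒ≥3
prime≢2⇒odd≥3 {p} pp p≢2 = odd (2∣n⊎odd p) , +≤+ (≤∧≢⇒< 2≤p (p≢2 ∘ sym))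
  where
  2≤p : 2 ≤ p
  2≤p = nonTrivial⇒n>1 p {{prime⇒nonTrivial pp}}

  odd : 2 ∣ p ⊎ Odd (+ p) → Odd (+ p)
  odd (inj₂ o) = o
  odd (inj₁ 2∣p) with prime⇒irreducible pp 2∣p
  ... | inj₂ 2≡p = contradiction (sym 2≡p) p≢2

-- A composite number exceeds 1, and oddness excludes 2. Negative integers are excluded by `0ℤ < z`,
-- which has no proof for them.
𝒞ᵒ>1⊆ℤᵒ≥3 : 𝒞ᵒ>1 ⊆ ℤᵒ≥3
𝒞ᵒ>1⊆ℤᵒ≥3 {+ n} (o , _ , c) = o , +≤+ (≤∧≢⇒< (nonTrivial⇒n>1 n {{composite⇒nonTrivial c}}) 2≢n)
  where
  2≢n : 2 ≢ n
  2≢n 2≡n = odd⇒2∤ o (subst (2 ∣_) 2≡n ∣-refl)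

-- The primes in [3, m + 2]; the shift makes π (+ (2 + m)) unfold to 1 + length (oddPrimes m).
oddPrimes : ℕ → List ℕ
oddPrimes m = filter prime? (applyUpTo (λ i → 3 + i) m)

oddPrimes-unique : ∀ m → Unique (oddPrimes m)
oddPrimes-unique m = Unique.filter⁺ prime? (Unique.applyUpTo⁺₁ _ m λ i<j _ eq → <⇒≢ i<j (+-cancelˡ-≡ 3 _ _ eq))

-- Carries a prime factorisation found in ℕ over to the integer product that `IsProductOf` asks for.
product-map-+ : ∀ ns → product (map +_ ns) ≡ + ℕ.product ns
product-map-+ []       = refl
product-map-+ (n ∷ ns) = trans (cong (+ n ℤ.*_) (product-map-+ ns)) (sym (ℤ.pos-* n _))

module _ (m : ℕ) where

  -- A sum of two integers that are at least 3 is at least 6, so `m` measures the excess over 6.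
  -- Then M = z - 3 is `3 + m`, and `oddPrimes (suc m)` lists the odd primes up to M.
  z : ℤ
  z = + (6 + m)

  oddPrime : Fin (length (oddPrimes (suc m))) → ℕ
  oddPrime = lookup (oddPrimes (suc m))

  oddPrime-prime : ∀ j → Prime (oddPrime j)
  oddPrime-prime j = proj₂ (∈-filter⁻ prime? {xs = applyUpTo (λ i → 3 + i) (suc m)} (∈-lookup j))

  oddPrime-bounds : ∀ j → 3 ≤ oddPrime j × oddPrime j ≤ 3 + m
  oddPrime-bounds j with ∈-applyUpTo⁻ (λ i → 3 + i) (proj₁ (∈-filter⁻ prime? (∈-lookup j)))
  ... | i , i<1+m , eq = subst (λ n → 3 ≤ n × n ≤ 3 + m) (sym eq) (m≤m+n 3 i , +-monoʳ-≤ 3 (s≤s⁻¹ i<1+m))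

  z-p≥3 : ∀ j → + 3 ℤ.≤ z ℤ.- + oddPrime j
  z-p≥3 j = subst (ℤ._≤ z ℤ.- + oddPrime j) (identity (+ m))
              (ℤ.+-monoʳ-≤ z (ℤ.neg-mono-≤ (+≤+ (proj₂ (oddPrime-bounds j)))))
    where
    identity : ∀ x → (+ 6 ℤ.+ x) ℤ.- (+ 3 ℤ.+ x) ≡ + 3
    identity = solve-∀

  z-p≤z-3 : ∀ j → z ℤ.- + oddPrime j ℤ.≤ + (3 + m)
  -- `z ℤ.- + 3` computes to `+ (3 + m)`, since only numerals have to be cancelled.
  z-p≤z-3 j = ℤ.+-monoʳ-≤ z (ℤ.neg-mono-≤ (+≤+ (proj₁ (oddPrime-bounds j))))

range? : ∀ {r} (k : Fin r → ℤ) → Decidable (Range k)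
range? k x = any? λ i → x ℤ.≟ k i

module _ {r} (k : Fin r → ℤ) (k∈𝒞 : ∀ i → k i ∈ 𝒞ᵒ>1) where

  Range⊆ : Range k ⊆ ℤᵒ≥3
  Range⊆ (i , refl) = 𝒞ᵒ>1⊆ℤᵒ≥3 (k∈𝒞 i)

  prime∉Range : ∀ {p} → Prime p → + p ∉ Range k
  prime∉Range pp (i , eq) = prime⇒¬composite pp (subst (Composite ∘ ∣_∣) (sym eq) (proj₂ (proj₂ (k∈𝒞 i))))

  oddPrime∈ : ∀ {p} → Prime p → p ≢ 2 → + p ∈ ℤᵒ≥3 ∖ Range k
  oddPrime∈ pp p≢2 = prime≢2⇒odd≥3 pp p≢2 , prime∉Range pp

  ℤᵒ≥3-factors : ℤᵒ≥3 ⊆ IsProductOf (ℤᵒ≥3 ∖ Range k)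
  -- The pattern `suc _` makes `n` visibly nonzero, as `factorise` requires.
  ℤᵒ≥3-factors {+ n@(suc _)} (n-odd , +≤+ 3≤n) =
    nonEmpty (factors n-fac) (isFactorisation n-fac) (factors∈ (factors n-fac) (factorsPrime n-fac) factor∣n)
    where
    open PrimeFactorisation
    n-fac = factorise n

    factor∣n : All (_∣ n) (factors n-fac)
    factor∣n = All.tabulate λ p∈ → subst (_ ∣_) (sym (isFactorisation n-fac)) (∈⇒∣product p∈)

    factors∈ : ∀ ps → All Prime ps → All (_∣ n) ps → All (_∈ ℤᵒ≥3 ∖ Range k) (map +_ ps)
    factors∈ []       []         []          = []
    factors∈ (p ∷ ps) (pp ∷ pps) (p∣n ∷ ps∣n) =
      oddPrime∈ pp (λ { refl → odd⇒2∤ n-odd p∣n }) ∷ factors∈ ps pps ps∣n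

    nonEmpty : ∀ ps → n ≡ ℕ.product ps → All (_∈ ℤᵒ≥3 ∖ Range k) (map +_ ps) →
               IsProductOf (ℤᵒ≥3 ∖ Range k) (+ n)
    -- An empty factorisation would mean that `n` is 1.
    nonEmpty []       refl _   = contradiction 3≤n λ { (s≤s ()) }
    nonEmpty (p ∷ ps) eq   ps∈ = + p ∷ map +_ ps , ps∈ , trans (cong +_ eq) (sym (product-map-+ (p ∷ ps)))

  module _ (π-bound : ∀ i → π (k i) ≥ suc (toℕ i) + 2) where

    ∃z-p∉Range : ∀ m → ∃ λ j → z m ℤ.- + oddPrime m j ∉ Range k
    ∃z-p∉Range m with any? (λ j → ¬? (range? k (z m ℤ.- + oddPrime m j)))
    ... | yes found = found
    -- Since 3 is prime and heads `oddPrimes (suc m)`, the length of this list computes to a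
    -- successor. So `index` would inject a finite set into one with one element fewer.
    ... | no  none  = ⊥-elim (<⇒notInjective (n<1+n _) (λ {j} {j′} → index-injective {j} {j′}))
      where
      z-p∈Range : ∀ j → z m ℤ.- + oddPrime m j ∈ Range k
      z-p∈Range j = decidable-stable (range? k _) λ ∉ → none (j , ∉)

      i : Fin (length (oddPrimes (suc m))) → Fin r
      i j = proj₁ (z-p∈Range j)

      i<#oddPrimes-1 : ∀ j → suc (toℕ (i j)) ≤ pred (length (oddPrimes (suc m)))
      -- `π (+ (3 + m))` computes to `2 + pred (length (oddPrimes (suc m)))`: the 2 counts the
      -- primes 2 and 3. It cancels against the 2 in the hypothesis on `π (k i)`.
      i<#oddPrimes-1 j = +-cancelʳ-≤ 2 _ _ (subst (suc (toℕ (i j)) + 2 ≤_) (+-comm 2 _)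
        (≤-trans (π-bound (i j))
          (π-mono-≤ (subst (ℤ._≤ + (3 + m)) (proj₂ (z-p∈Range j)) (z-p≤z-3 m j)))))

      index : Fin (length (oddPrimes (suc m))) → Fin (pred (length (oddPrimes (suc m))))
      index j = Fin.fromℕ< (i<#oddPrimes-1 j)

      -- Primes sharing an index `i` have the same difference z - p, namely `k i`. Hence they are
      -- equal, and the list has no repetitions.
      index-injective : Injective _≡_ _≡_ index
      index-injective {j} {j′} eq = lookup-injective (oddPrimes-unique (suc m)) p≡p′
        where
        i≡i′ : i j ≡ i j′
        i≡i′ = toℕ-injective (fromℕ<-injective _ _ (i<#oddPrimes-1 j) (i<#oddPrimes-1 j′) eq)

        z-p≡z-p′ : z m ℤ.- + oddPrime m j ≡ z m ℤ.- + oddPrime m j′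
        z-p≡z-p′ = trans (proj₂ (z-p∈Range j)) (trans (cong k i≡i′) (sym (proj₂ (z-p∈Range j′))))

        p≡p′ : oddPrime m j ≡ oddPrime m j′
        p≡p′ = ℤ.+-injective (ℤ.neg-injective (∙-cancelˡ (z m) _ _ z-p≡z-p′))

    2⊕-⊆ : 2⊕ ℤᵒ≥3 ⊆ 2⊕ (ℤᵒ≥3 ∖ Range k)
    2⊕-⊆ (s , s′ , (s-odd , 3≤s) , (s′-odd , 3≤s′) , refl) = split (ℤ.+-mono-≤ 3≤s 3≤s′) refl
      where
      -- A variable stands for `s ℤ.+ s′` so that matching on the bound by 6 can put it into the
      -- form `+ (6 + m)`.
      split : ∀ {z} → + 6 ℤ.≤ z → z ≡ s ℤ.+ s′ → (2⊕ (ℤᵒ≥3 ∖ Range k)) z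
      split (+≤+ (s≤s (s≤s (s≤s (s≤s (s≤s (s≤s (z≤n {m})))))))) z≡s+s′ =
        + oddPrime m j , z m ℤ.- + oddPrime m j , p∈ , ((z-p-odd , z-p≥3 m j) , z-p∉) , cancel (+ oddPrime m j) (z m)
        where
        j    = proj₁ (∃z-p∉Range m)
        z-p∉ = proj₂ (∃z-p∉Range m)

        p∈ : + oddPrime m j ∈ ℤᵒ≥3 ∖ Range k
        -- The bound `3 ≤ p` is by definition `2 < p`, which gives `p ≢ 2`.
        p∈ = oddPrime∈ (oddPrime-prime m j) (<⇒≢ (proj₁ (oddPrime-bounds m j)) ∘ sym)

        z-p-odd : Odd (z m ℤ.- + oddPrime m j)
        z-p-odd = subst (λ x → Odd (x ℤ.- + oddPrime m j)) (sym z≡s+s′) (odd-+- s-odd s′-odd (proj₁ (proj₁ p∈)))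

        cancel : ∀ x y → y ≡ x ℤ.+ (y ℤ.- x)
        cancel = solve-∀

    2⊕-≐ : 2⊕ ℤᵒ≥3 ≐ 2⊕ (ℤᵒ≥3 ∖ Range k)
    2⊕-≐ = 2⊕-⊆ , λ (s , s′ , s∈ , s′∈ , eq) → s , s′ , proj₁ s∈ , proj₁ s′∈ , eq

theorem3p8 : (r : ℕ) → r ≥ 3 → (k : Fin r → ℤ) →
    (∀ i j → i Fin.< j → k i ℤ.< k j) →
    (∀ i → k i ∈ 𝒞ᵒ>1) →
    (∀ i → π (k i) ≥ suc (toℕ i) + 2) →
    (2⊕ ℤᵒ≥3 ≐ 2⊕ (ℤᵒ≥3 ∖ Range k)) × SumFactorCollapsed₂ (Range k) ℤᵒ≥3
theorem3p8 r _ k _ k∈𝒞 π-bound = sums , record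
  { B-nonEmpty   = + 3 , proj₁ 3∈
  ; C⊆B          = Range⊆ k k∈𝒞
  ; B∖C-nonEmpty = + 3 , 3∈
  ; sumset-≐     = sums
  ; factors      = ℤᵒ≥3-factors k k∈𝒞
  }
  where
  sums : 2⊕ ℤᵒ≥3 ≐ 2⊕ (ℤᵒ≥3 ∖ Range k)
  sums = 2⊕-≐ k k∈𝒞 π-bound

  3∈ : + 3 ∈ ℤᵒ≥3 ∖ Range k
  -- The primality of 3 is established by running the decision procedure.
  3∈ = oddPrime∈ k k∈𝒞 (toWitness {a? = prime? 3} _) λ ()
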